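{- Let $G$ be a group with a gliding system and $\mathcal{D}\subset G$. The glide complex $X_{\mathcal{D}}$ is nonpositively curved if and only if $\mathcal{D}$ is regular and satisfies the cube condition.
   Context: Gliding system $(\mathcal{G},\mathcal{I})$ in $G$: $\mathcal{G}\subset G\setminus\{1\}$ closed under inversion (glides), $\mathcal{I}\subset\mathcal{G}\times\mathcal{G}$ (independence) with $(s^{ -1},t),(t,s)\in\mathcal{I}$ and $st=ts\ne1$ whenever $(s,t)\in\mathcal{I}$. Pre-cubic set: finite set $S$ of pairwise independent glides, $[S]=\prod_{s\in S}s$; cubic: pre-cubic with $[T_1]\ne[T_2]$ for distinct $T_1,T_2\subset S$. Glide complex $X_G$: cubed complex with one $k$-cube for each equivalence class of based cubes $(A,S)$ ($A\in G$, $S$ cubic of size $k$) under $(A,S)\sim([T]A,(S\setminus T)\cup\{t^{ -1}:t\in T\})$, $T\subset S$; vertices of the cube are $[T]A$ ($T\subset S$), faces are cubes of $(A,S')$, $S'\subset S$; 0-skeleton $G$. $X_{\mathcal{D}}$: subcomplex of cubes all of whose vertices lie in $\mathcal{D}$. $\mathcal{D}$ is regular if for every $A\in\mathcal{D}$ every pre-cubic $S$ with $sA\in\mathcal{D}$ ($s\in S$) and $stA\in\mathcal{D}$ (distinct $s,t\in S$) is cubic. $\mathcal{D}$ satisfies the cube condition if for every $A\in\mathcal{D}$ and pairwise independent glides $s_1,s_2,s_3$ with $s_1A,s_2A,s_3A,s_1s_2A,s_1s_3A,s_2s_3A\in\mathcal{D}$ one has $s_1s_2s_3A\in\mathcal{D}$.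 A cubed complex is nonpositively curved if the link of every $0$-cell is a simplicial complex and is a flag complex. -}

module Defs where

open import Algebra.Bundles using (Group)
import Algebra.Properties.Group as GroupProperties
open import Data.Bool.Base using (Bool; true; false; not; _∧_; _∨_; _xor_; if_then_else_)
open import Data.Bool.Properties using (xor-identityʳ; not-injective)
open import Data.Empty using (⊥-elim)
open import Data.Fin.Base using (Fin; zero; suc)
open import Data.Fin.Properties using (_≟_; any?; suc-injective; 0≢1+n)
open import Data.Nat.Base using (ℕ; zero; suc)
open import Data.Product.Base using (Σ-syntax; ∃-syntax; _×_; _,_; proj₁; proj₂)
open import Data.Vec.Functional using (Vector; foldr; tail)
open import Function.Base using (id; _∘_)
open import Function.Bundles using (_↣_; mk↣; Injection)
open import Function.Construct.Composition using (_↣-∘_)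
open import Function.Construct.Identity using (↣-id)
open import Level using (Level; _⊔_) renaming (suc to lsuc)
open import Relation.Binary.Core using (Rel)
open import Relation.Binary.Definitions using (_Respects_; _Respects₂_)
open import Relation.Binary.PropositionalEquality
  using (_≡_; _≢_; _≗_; refl; sym; trans; cong; module ≡-Reasoning)
open import Relation.Binary.Structures using (IsEquivalence)
import Relation.Binary.Reasoning.Setoid as ≈-Reasoning
open import Relation.Nullary using (¬_; yes; no; does)
open import Relation.Nullary.Decidable using (dec-true; dec-false)
open import Relation.Unary using (Pred)

private variable
  i j k l m n : ℕ

open Injection using (to; injective)

------------------------------------------------------------------------
-- Isometries of cubes onto faces

-- The vertices of the cube [0,1]ᵏ.  The same type also encodes the
-- subsets of a k-element set.
Vertex : ℕ → Set
Vertex k = Vector Bool k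

𝟎 : Vertex k
𝟎 _ = false

-- The vector Σᵢ vᵢ e_{p i}; for subsets, the image of v under p.
spread : Fin j ↣ Fin k → Vertex j → Vertex k
spread p v m = foldr _∨_ false (λ i → v i ∧ does (to p i ≟ m))

-- An isometry of Iʲ onto a j-dimensional face of Iᵏ is determined by the
-- image of the origin and by the axis of Iᵏ to which each axis of Iʲ is
-- made parallel; both can be prescribed arbitrarily.
record FaceMap (j k : ℕ) : Set where
  constructor faceMap
  field
    origin : Vertex k
    axes   : Fin j ↣ Fin k

open FaceMap

infix 4 _≋_
_≋_ : FaceMap j k → FaceMap j k → Set
e ≋ f = (origin e ≗ origin f) × (to (axes e) ≗ to (axes f))

-- The effect of an isometry on vertices.
apply : FaceMap j k → Vertex j → Vertex k
apply e v m = origin e m xor spread (axes e) v m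

idᶠ : FaceMap k k
idᶠ = faceMap 𝟎 (↣-id _)

infixr 9 _∘ᶠ_
_∘ᶠ_ : FaceMap j k → FaceMap i j → FaceMap i k
e ∘ᶠ f = faceMap (apply e (origin f)) (axes e ↣-∘ axes f)

[]↣ : Fin 0 ↣ Fin k
[]↣ = mk↣ {to = λ ()} λ { {()} }

point : Fin k → Fin 1 ↣ Fin k
point m = mk↣ {to = λ _ → m} λ {x} {y} _ → Fin1-unique x y
  where
  Fin1-unique : (x y : Fin 1) → x ≡ y
  Fin1-unique zero zero = refl

atVertex : Vertex k → FaceMap 0 k
atVertex v = faceMap v []↣

------------------------------------------------------------------------
-- Cubed complexes

-- A cubed complex is presented by its parametrised cubes: an element of
-- Cell k is a k-cell Iᵏ → X precomposed with an isometry of Iᵏ, and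
-- restrict precomposes further with an isometry onto a face.  The
-- unparametrised k-cubes are the orbits of Cell k under the isometries of
-- Iᵏ.  That a characteristic map is injective on the interior of Iᵏ means
-- that these isometries act freely.
record CubedComplex (a b : Level) : Set (lsuc (a ⊔ b)) where
  infix 4 _≈_
  field
    Cell          : ℕ → Set a
    _≈_           : Rel (Cell k) b
    isEquivalence : IsEquivalence (_≈_ {k})
    restrict      : Cell k → FaceMap j k → Cell j
    restrict-cong : {x y : Cell k} {e f : FaceMap j k} →
                    x ≈ y → e ≋ f → restrict x e ≈ restrict y f
    restrict-id   : (x : Cell k) → restrict x idᶠ ≈ x
    restrict-∘    : (x : Cell k) (e : FaceMap j k) (f : FaceMap i j) →
                    restrict x (e ∘ᶠ f) ≈ restrict (restrict x e) f
    free          : (x : Cell k) (e : FaceMap k k) → restrict x e ≈ x → e ≋ idᶠ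

  vertex : Cell k → Vertex k → Cell 0
  vertex x v = restrict x (atVertex v)

-- Spaces glued from simplices along their faces, presented in the same way:
-- an element of Simplex n is an n-simplex with an ordering of its n + 1
-- vertices (for simplices that need not be embedded, of its corners).
record SimplexComplex (a b : Level) : Set (lsuc (a ⊔ b)) where
  infix 4 _≈_
  field
    Simplex       : ℕ → Set a
    _≈_           : Rel (Simplex n) b
    isEquivalence : IsEquivalence (_≈_ {n})
    face          : Simplex n → Fin (suc m) ↣ Fin (suc n) → Simplex m
    face-cong     : {σ τ : Simplex n} {p q : Fin (suc m) ↣ Fin (suc n)} →
                    σ ≈ τ → to p ≗ to q → face σ p ≈ face τ q
    face-id       : (σ : Simplex n) → face σ (↣-id _) ≈ σ
    face-∘        : (σ : Simplex n) (p : Fin (suc m) ↣ Fin (suc n))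
                    (q : Fin (suc l) ↣ Fin (suc m)) →
                    face σ (p ↣-∘ q) ≈ face (face σ p) q

  corner : Simplex n → Fin (suc n) → Simplex 0
  corner σ i = face σ (point i)

  _⊆ᵛ_ : Simplex m → Simplex n → Set b
  σ ⊆ᵛ τ = ∀ i → ∃[ j ] corner σ i ≈ corner τ j

  Adjacent : Simplex 0 → Simplex 0 → Set (a ⊔ b)
  Adjacent u v = Σ[ e ∈ Simplex 1 ] (corner e zero ≈ u × corner e (suc zero) ≈ v)

-- Each simplex has distinct vertices (equivalently, is embedded), and no two
-- simplices have the same vertex set.  The permutation p accounts for the
-- orderings of the vertices.  Simplices of different dimensions have different
-- vertex sets by embeddedness.
record IsSimplicialComplex {a b} (L : SimplexComplex a b) : Set (a ⊔ b) where
  open SimplexComplex L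
  field
    embedded   : (σ : Simplex n) → ∀ {i j} → corner σ i ≈ corner σ j → i ≡ j
    determined : (σ τ : Simplex n) → σ ⊆ᵛ τ → τ ⊆ᵛ σ →
                 Σ[ p ∈ Fin (suc n) ↣ Fin (suc n) ] σ ≈ face τ p

IsFlag : ∀ {a b} → SimplexComplex a b → Set (a ⊔ b)
IsFlag L = ∀ {n} (v : Fin (suc n) → Simplex 0) →
           (∀ {i j} → i ≢ j → Adjacent (v i) (v j)) →
           Σ[ σ ∈ Simplex n ] (∀ i → corner σ i ≈ v i)
  where open SimplexComplex L

------------------------------------------------------------------------
-- Composition of isometries

spread-miss : (p : Fin j ↣ Fin k) (v : Vertex j) (m : Fin k) →
              (∀ i → to p i ≢ m) → spread p v m ≡ false
spread-miss {zero}  p v m miss = refl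
spread-miss {suc j} p v m miss with v zero
... | false = spread-miss (p ↣-∘ mk↣ suc-injective) (tail v) m (miss ∘ suc)
... | true rewrite dec-false (to p zero ≟ m) (miss zero) =
  spread-miss (p ↣-∘ mk↣ suc-injective) (tail v) m (miss ∘ suc)

spread-hit : (p : Fin j ↣ Fin k) (v : Vertex j) (i : Fin j) →
             spread p v (to p i) ≡ v i
spread-hit {suc j} p v zero
  rewrite dec-true (to p zero ≟ to p zero) refl
        | spread-miss (p ↣-∘ mk↣ suc-injective) (tail v) (to p zero)
            (λ i eq → 0≢1+n (injective p (sym eq)))
  with v zero
... | false = refl
... | true  = refl
spread-hit {suc j} p v (suc i)
  rewrite dec-false (to p zero ≟ to p (suc i)) (λ eq → 0≢1+n (injective p eq))
  with v zero
... | false = spread-hit (p ↣-∘ mk↣ suc-injective) (tail v) i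
... | true  = spread-hit (p ↣-∘ mk↣ suc-injective) (tail v) i

spread-unique : (p : Fin j ↣ Fin k) (v : Vertex j) (w : Vertex k) →
                (∀ i → w (to p i) ≡ v i) →
                (∀ m → (∀ i → to p i ≢ m) → w m ≡ false) →
                w ≗ spread p v
spread-unique p v w hit miss m with any? (λ i → to p i ≟ m)
... | yes (i , refl) = trans (hit i) (sym (spread-hit p v i))
... | no ∄i = trans (miss m λ i eq → ∄i (i , eq))
                    (sym (spread-miss p v m λ i eq → ∄i (i , eq)))

spread-𝟎 : (p : Fin j ↣ Fin k) → spread p 𝟎 ≗ 𝟎
spread-𝟎 p m = sym (spread-unique p 𝟎 𝟎 (λ _ → refl) (λ _ _ → refl) m)

xor-cancelˡ : ∀ x {y z} → x xor y ≡ x xor z → y ≡ z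
xor-cancelˡ false eq = eq
xor-cancelˡ true  eq = not-injective eq

apply-injective : (e : FaceMap j k) {v w : Vertex j} → apply e v ≗ apply e w → v ≗ w
apply-injective e {v} {w} eq i = begin
  v i                                  ≡⟨ spread-hit (axes e) v i ⟨
  spread (axes e) v (to (axes e) i)    ≡⟨ xor-cancelˡ (origin e _) (eq _) ⟩
  spread (axes e) w (to (axes e) i)    ≡⟨ spread-hit (axes e) w i ⟩
  w i                                  ∎
  where open ≡-Reasoning

atVertex-∘ : (e : FaceMap j k) (v : Vertex j) → (e ∘ᶠ atVertex v) ≋ atVertex (apply e v)
atVertex-∘ e v = (λ _ → refl) , λ ()

------------------------------------------------------------------------
-- Full subcomplexes

-- The subcomplex of the cubes all of whose vertices satisfy P.
fullSubcomplex : ∀ {a b d} (X : CubedComplex a b) (P : Pred (CubedComplex.Cell X 0) d) →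
                 P Respects (CubedComplex._≈_ X) → CubedComplex (a ⊔ d) b
fullSubcomplex X P P-resp = record
  { Cell          = λ k → Σ[ x ∈ Cell k ] (∀ v → P (vertex x v))
  ; _≈_           = λ x y → proj₁ x ≈ proj₁ y
  ; isEquivalence = record { refl = ≈.refl ; sym = ≈.sym ; trans = ≈.trans }
  ; restrict      = λ (x , Px) e → restrict x e , λ v →
      P-resp (≈.trans (restrict-cong ≈.refl
                        (sym≋ {e = e ∘ᶠ atVertex v} {atVertex (apply e v)} (atVertex-∘ e v)))
                      (restrict-∘ x e (atVertex v)))
             (Px (apply e v))
  ; restrict-cong = restrict-cong
  ; restrict-id   = λ x → restrict-id (proj₁ x)
  ; restrict-∘    = λ x → restrict-∘ (proj₁ x)
  ; free          = λ x → free (proj₁ x)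
  }
  where
  open CubedComplex X
  module ≈ {k} = IsEquivalence (isEquivalence {k})
  sym≋ : {e f : FaceMap j k} → e ≋ f → f ≋ e
  sym≋ (o , a) = (λ m → sym (o m)) , λ i → sym (a i)

------------------------------------------------------------------------
-- Links and curvature

-- The simplices of the link of A come from the pairs (a cell I^{n+1} → X,
-- a vertex of I^{n+1} carried to A).  Such a pair together with an ordering
-- of the n + 1 edges at that vertex amounts to a parametrised cube
-- carrying the origin to A.  Faces of the simplex come from the faces of
-- the cube through the origin.
link : ∀ {a b} (X : CubedComplex a b) → CubedComplex.Cell X 0 → SimplexComplex (a ⊔ b) b
link X A = record
  { Simplex       = λ n → Σ[ x ∈ Cell (suc n) ] vertex x 𝟎 ≈ A
  ; _≈_           = λ σ τ → proj₁ σ ≈ proj₁ τ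
  ; isEquivalence = record { refl = ≈.refl ; sym = ≈.sym ; trans = ≈.trans }
  ; face          = λ (x , x𝟎≈A) p → restrict x (faceMap 𝟎 p) ,
      ≈.trans (≈.sym (restrict-∘ x (faceMap 𝟎 p) (atVertex 𝟎)))
              (≈.trans (restrict-cong ≈.refl (spread-𝟎 p , λ ())) x𝟎≈A)
  ; face-cong     = λ σ≈τ p≗q → restrict-cong σ≈τ ((λ _ → refl) , p≗q)
  ; face-id       = λ σ → restrict-id (proj₁ σ)
  ; face-∘        = λ (x , _) p q →
      ≈.trans (restrict-cong ≈.refl ((λ m → sym (spread-𝟎 p m)) , λ _ → refl))
              (restrict-∘ x (faceMap 𝟎 p) (faceMap 𝟎 q))
  }
  where
  open CubedComplex X
  module ≈ {k} = IsEquivalence (isEquivalence {k})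

NonpositivelyCurved : ∀ {a b} → CubedComplex a b → Set (a ⊔ b)
NonpositivelyCurved X = ∀ A → IsSimplicialComplex (link X A) × IsFlag (link X A)

------------------------------------------------------------------------
-- Gliding systems

record GlidingSystem {c ℓ} (G : Group c ℓ) (g h : Level) :
       Set (c ⊔ ℓ ⊔ lsuc (g ⊔ h)) where
  open Group G using (Carrier; _≈_; _≉_; _∙_; ε; _⁻¹)
  field
    Glide       : Pred Carrier g
    Indep       : Rel Carrier h
    Glide-resp  : Glide Respects _≈_
    Indep-resp  : Indep Respects₂ _≈_
    Glide⇒≉ε    : ∀ {s} → Glide s → s ≉ ε
    Glide-⁻¹    : ∀ {s} → Glide s → Glide (s ⁻¹)
    Indep⇒Glide : ∀ {s t} → Indep s t → Glide s × Glide t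
    Indep-⁻¹ˡ   : ∀ {s t} → Indep s t → Indep (s ⁻¹) t
    Indep-sym   : ∀ {s t} → Indep s t → Indep t s
    Indep-comm  : ∀ {s t} → Indep s t → s ∙ t ≈ t ∙ s
    Indep-≉ε    : ∀ {s t} → Indep s t → s ∙ t ≉ ε

module _ {c ℓ g h} {G : Group c ℓ} (𝒮 : GlidingSystem G g h) where
  open Group G renaming (refl to ≈-refl; sym to ≈-sym; trans to ≈-trans)
  open GlidingSystem 𝒮
  open GroupProperties G

  -- [T] for a subset T of the finite set {s₀ , … , s_{k-1}}.
  prod : Vector Carrier k → Vertex k → Carrier
  prod s T = foldr _∙_ ε (λ i → if T i then s i else ε)

  -- Finite sets of glides are given by enumerations without repetition;
  -- independent glides are never equal, so s is automatically injective.
  PreCubic : Vector Carrier k → Set (g ⊔ h)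
  PreCubic s = (∀ i → Glide (s i)) × (∀ {i j} → i ≢ j → Indep (s i) (s j))

  Cubic : Vector Carrier k → Set (ℓ ⊔ g ⊔ h)
  Cubic s = PreCubic s × (∀ T₁ T₂ → ¬ (T₁ ≗ T₂) → prod s T₁ ≉ prod s T₂)

  record BasedCube (k : ℕ) : Set (c ⊔ ℓ ⊔ g ⊔ h) where
    constructor basedCube
    field
      base  : Carrier
      dirs  : Vector Carrier k
      cubic : Cubic dirs

  open BasedCube

  signed : Bool → Carrier → Carrier
  signed b s = if b then s ⁻¹ else s

  Indep⇒≉ : ∀ {s t} → Indep s t → s ≉ t
  Indep⇒≉ {s} {t} st s≈t = Indep-≉ε (Indep-⁻¹ˡ st) (≈-trans (∙-congʳ (⁻¹-cong s≈t)) (inverseˡ t))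

  signed-cong : ∀ {b b′ s s′} → b ≡ b′ → s ≈ s′ → signed b s ≈ signed b′ s′
  signed-cong {true}  refl s≈s′ = ⁻¹-cong s≈s′
  signed-cong {false} refl s≈s′ = s≈s′

  signed-Glide : ∀ b {s} → Glide s → Glide (signed b s)
  signed-Glide true  = Glide-⁻¹
  signed-Glide false = id

  signed-Indepˡ : ∀ b {s t} → Indep s t → Indep (signed b s) t
  signed-Indepˡ true  = Indep-⁻¹ˡ
  signed-Indepˡ false = id

  signed-xor : ∀ b b′ s → signed (b xor b′) s ≈ signed b′ (signed b s)
  signed-xor true  true  s = ≈-sym (⁻¹-involutive s)
  signed-xor true  false s = ≈-refl
  signed-xor false b′    s = ≈-refl

  if-cong : ∀ {b b′ s s′} → b ≡ b′ → s ≈ s′ → (if b then s else ε) ≈ (if b′ then s′ else ε)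
  if-cong {true}  refl s≈s′ = s≈s′
  if-cong {false} refl s≈s′ = ≈-refl

  prod-cong : {s s′ : Vector Carrier k} {T T′ : Vertex k} →
              (∀ i → s i ≈ s′ i) → T ≗ T′ → prod s T ≈ prod s′ T′
  prod-cong {k = zero}  s≈s′ T≗T′ = ≈-refl
  prod-cong {k = suc k} s≈s′ T≗T′ = ∙-cong (if-cong (T≗T′ zero) (s≈s′ zero))
                                           (prod-cong (s≈s′ ∘ suc) (T≗T′ ∘ suc))

  prod-𝟎 : (s : Vector Carrier k) → prod s 𝟎 ≈ ε
  prod-𝟎 {k = zero}  s = ≈-refl
  prod-𝟎 {k = suc k} s = ≈-trans (identityˡ _) (prod-𝟎 (tail s))

  PreCubic-tail : {s : Vector Carrier (suc k)} → PreCubic s → PreCubic (tail s)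
  PreCubic-tail (gl , ind) = gl ∘ suc , λ i≢j → ind (i≢j ∘ suc-injective)

  if-comm : ∀ b {s t} → s ∙ t ≈ t ∙ s → (if b then s else ε) ∙ t ≈ t ∙ (if b then s else ε)
  if-comm true  eq = eq
  if-comm false eq = ≈-trans (identityˡ _) (≈-sym (identityʳ _))

  -- Adding or removing one element of a subset.
  prod-flip : {s : Vector Carrier k} → PreCubic s → (T U : Vertex k) (m : Fin k) →
              U m ≡ not (T m) → (∀ i → i ≢ m → U i ≡ T i) →
              prod s U ≈ signed (T m) (s m) ∙ prod s T
  prod-flip {k = suc k} {s} pc T U zero flip rest
    rewrite flip with T zero
  ... | true  = ≈-trans (identityˡ _) (≈-trans
                  (prod-cong (λ _ → ≈-refl) (λ i → rest (suc i) λ ()))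
                  (≈-sym (\\-leftDividesʳ _ _)))
  ... | false = ∙-congˡ (≈-trans
                  (prod-cong (λ _ → ≈-refl) (λ i → rest (suc i) λ ()))
                  (≈-sym (identityˡ _)))
  prod-flip {k = suc k} {s} pc T U (suc m) flip rest = begin
    (if U zero then s zero else ε) ∙ prod (tail s) (tail U)
      ≈⟨ ∙-cong (if-cong (rest zero λ ()) ≈-refl)
                (prod-flip (PreCubic-tail pc) (tail T) (tail U) m flip
                           (λ i i≢m → rest (suc i) (i≢m ∘ suc-injective))) ⟩
    (if T zero then s zero else ε) ∙ (sₘ ∙ prod (tail s) (tail T))
      ≈⟨ assoc _ _ _ ⟨
    (if T zero then s zero else ε) ∙ sₘ ∙ prod (tail s) (tail T)
      ≈⟨ ∙-congʳ (if-comm (T zero) (≈-sym (Indep-comm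
           (signed-Indepˡ (T (suc m)) (proj₂ pc λ ()))))) ⟩
    sₘ ∙ (if T zero then s zero else ε) ∙ prod (tail s) (tail T)
      ≈⟨ assoc _ _ _ ⟩
    sₘ ∙ prod s T ∎
    where
    open ≈-Reasoning setoid
    sₘ = signed (T (suc m)) (s (suc m))

  -- The direction of the i-th axis after passing to the face e: reflecting an
  -- axis inverts the corresponding glide.
  moved : Vector Carrier k → FaceMap j k → Vector Carrier j
  moved s e i = signed (origin e (to (axes e) i)) (s (to (axes e) i))

  prod-apply : {s : Vector Carrier k} → PreCubic s → (e : FaceMap j k) (T : Vertex j) →
               prod s (apply e T) ≈ prod (moved s e) T ∙ prod s (origin e)
  prod-apply {j = zero} {s} pc e T =
    ≈-trans (prod-cong {s = s} {T = apply e T} (λ _ → ≈-refl) (λ m → xor-identityʳ _))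
            (≈-sym (identityˡ _))
  prod-apply {j = suc j} {s} pc e T = step (T zero) refl
    where
    open ≈-Reasoning setoid
    p  = axes e
    p₀ = to p zero
    e′ = faceMap (origin e) (p ↣-∘ mk↣ suc-injective)
    IH : prod s (apply e′ (tail T)) ≈ prod (tail (moved s e)) (tail T) ∙ prod s (origin e)
    IH = prod-apply pc e′ (tail T)

    at-p₀ : apply e′ (tail T) p₀ ≡ origin e p₀
    at-p₀ = trans (cong (origin e p₀ xor_)
              (spread-miss (axes e′) (tail T) p₀ λ i eq → 0≢1+n (injective p (sym eq))))
              (xor-identityʳ _)

    xor-true : ∀ x → x xor true ≡ not x
    xor-true true  = refl
    xor-true false = refl

    step : ∀ b → T zero ≡ b →
           prod s (apply e T) ≈ prod (moved s e) T ∙ prod s (origin e)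
    step false eq rewrite eq = begin
      prod s (λ m → origin e m xor spread (axes e′) (tail T) m)       ≈⟨ IH ⟩
      prod (tail (moved s e)) (tail T) ∙ prod s (origin e)            ≈⟨ ∙-congʳ (identityˡ _) ⟨
      ε ∙ prod (tail (moved s e)) (tail T) ∙ prod s (origin e)        ∎
    step true eq = begin
      prod s (apply e T)
        ≈⟨ prod-flip pc (apply e′ (tail T)) (apply e T) p₀
             (trans (cong (origin e p₀ xor_) (trans (spread-hit p T zero) eq))
                    (trans (xor-true _) (cong not (sym at-p₀))))
             unchanged ⟩
      signed (apply e′ (tail T) p₀) (s p₀) ∙ prod s (apply e′ (tail T))
        ≈⟨ ∙-cong (signed-cong at-p₀ ≈-refl) IH ⟩
      moved s e zero ∙ (prod (tail (moved s e)) (tail T) ∙ prod s (origin e))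
        ≈⟨ assoc _ _ _ ⟨
      moved s e zero ∙ prod (tail (moved s e)) (tail T) ∙ prod s (origin e)
        ≈⟨ ∙-congʳ (∙-congʳ (if-cong {b = true} (sym eq) ≈-refl)) ⟩
      prod (moved s e) T ∙ prod s (origin e) ∎
      where
      unchanged : ∀ i → i ≢ p₀ → apply e T i ≡ apply e′ (tail T) i
      unchanged i i≢p₀
        rewrite eq | dec-false (p₀ ≟ i) (i≢p₀ ∘ sym) = refl

  moved-PreCubic : {s : Vector Carrier k} → PreCubic s → (e : FaceMap j k) → PreCubic (moved s e)
  moved-PreCubic (gl , ind) e =
    (λ i → signed-Glide (origin e _) (gl _)) ,
    λ i≢j → signed-Indepˡ (origin e _) (Indep-sym
              (signed-Indepˡ (origin e _) (Indep-sym (ind (i≢j ∘ injective (axes e))))))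

  moved-Cubic : {s : Vector Carrier k} → Cubic s → (e : FaceMap j k) → Cubic (moved s e)
  moved-Cubic (pc , distinct) e = moved-PreCubic pc e , λ T₁ T₂ T₁≢T₂ eq →
    distinct (apply e T₁) (apply e T₂) (T₁≢T₂ ∘ apply-injective e)
      (≈-trans (prod-apply pc e T₁) (≈-trans (∙-congʳ eq) (≈-sym (prod-apply pc e T₂))))

  moved-∘ : (s : Vector Carrier k) (e : FaceMap j k) (f : FaceMap i j) →
            ∀ m → moved s (e ∘ᶠ f) m ≈ moved (moved s e) f m
  moved-∘ s e f m = ≈-trans
    (signed-cong (cong (origin e _ xor_) (spread-hit (axes e) (origin f) _)) ≈-refl)
    (signed-xor (origin e _) (origin f _) _)

  moved-cong : {s s′ : Vector Carrier k} {e f : FaceMap j k} →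
               (∀ i → s i ≈ s′ i) → e ≋ f → ∀ i → moved s e i ≈ moved s′ f i
  moved-cong {s = s} {s′} {e} {f} s≈s′ (o , a) i =
    signed-cong (trans (o _) (cong (origin f) (a i)))
                (≈-trans (s≈s′ _) (reflexive (cong s′ (a i))))

  -- The vertex v of the parametrised cube (A , s) is [v] A, and the isometries
  -- of Iᵏ act by (A , S) ↦ ([T] A , (S ∖ T) ∪ T⁻¹) and by permutations of the
  -- enumeration s of S, so that their orbits are exactly the equivalence
  -- classes of based cubes.
  restrictBased : BasedCube k → FaceMap j k → BasedCube j
  restrictBased (basedCube A s cub) e = basedCube
    (prod s (origin e) ∙ A)
    (moved s e)
    (moved-Cubic cub e)

  -- The complex X_G.
  fullGlideComplex : CubedComplex (c ⊔ ℓ ⊔ g ⊔ h) ℓ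
  fullGlideComplex = record
    { Cell          = BasedCube
    ; _≈_           = λ x y → base x ≈ base y × (∀ i → dirs x i ≈ dirs y i)
    ; isEquivalence = record
        { refl  = ≈-refl , λ _ → ≈-refl
        ; sym   = λ (p , q) → ≈-sym p , λ i → ≈-sym (q i)
        ; trans = λ (p , q) (p′ , q′) → ≈-trans p p′ , λ i → ≈-trans (q i) (q′ i)
        }
    ; restrict      = restrictBased
    ; restrict-cong = λ {_} {_} {x} {y} {e} {f} (p , q) (o , a) →
        ∙-cong (prod-cong q o) p , moved-cong {e = e} {f} q (o , a)
    ; restrict-id   = λ (basedCube A s _) →
        ≈-trans (∙-congʳ (prod-𝟎 s)) (identityˡ A) , λ _ → ≈-refl
    ; restrict-∘    = λ (basedCube A s (pc , _)) e f →
        ≈-trans (∙-congʳ (prod-apply pc e (origin f))) (assoc _ _ _) , moved-∘ s e f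
    ; free          = λ (basedCube A s (pc , distinct)) e (p , q) →
        let o = origin-𝟎 s distinct (origin e) (identityˡ-unique _ _ p) in
        o , axes-id s pc e o q
    }
    where
    origin-𝟎 : (s : Vector Carrier k) →
               (∀ T₁ T₂ → ¬ (T₁ ≗ T₂) → prod s T₁ ≉ prod s T₂) →
               (T : Vertex k) → prod s T ≈ ε → T ≗ 𝟎
    origin-𝟎 s distinct T eq m with T m in Tm
    ... | false = refl
    ... | true  = ⊥-elim (distinct T 𝟎 (λ T≗𝟎 → true≢false (trans (sym Tm) (T≗𝟎 m)))
                                       (≈-trans eq (≈-sym (prod-𝟎 s))))
      where true≢false : true ≢ false
            true≢false ()

    axes-id : (s : Vector Carrier k) → PreCubic s → (e : FaceMap k k) → origin e ≗ 𝟎 →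
              (∀ i → moved s e i ≈ s i) → to (axes e) ≗ id
    axes-id s (_ , ind) e o q i with to (axes e) i ≟ i
    ... | yes eq = eq
    ... | no neq = ⊥-elim (Indep⇒≉ (ind neq)
                     (≈-trans (signed-cong (sym (o (to (axes e) i))) ≈-refl) (q i)))

  module _ {d} (𝒟 : Pred Carrier d) where

    -- The complex X_𝒟.
    glideComplex : 𝒟 Respects _≈_ → CubedComplex (c ⊔ ℓ ⊔ g ⊔ h ⊔ d) ℓ
    glideComplex 𝒟-resp = fullSubcomplex fullGlideComplex (𝒟 ∘ base) (𝒟-resp ∘ proj₁)

    Regular : Set (c ⊔ ℓ ⊔ g ⊔ h ⊔ d)
    Regular = ∀ {A} → 𝒟 A → ∀ {k} (s : Vector Carrier k) → PreCubic s →
              (∀ i → 𝒟 (s i ∙ A)) →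
              (∀ {i j} → i ≢ j → 𝒟 (s i ∙ s j ∙ A)) →
              Cubic s

    CubeCondition : Set (c ⊔ h ⊔ d)
    CubeCondition = ∀ {A s₁ s₂ s₃} → 𝒟 A →
                    Indep s₁ s₂ → Indep s₁ s₃ → Indep s₂ s₃ →
                    𝒟 (s₁ ∙ A) → 𝒟 (s₂ ∙ A) → 𝒟 (s₃ ∙ A) →
                    𝒟 (s₁ ∙ s₂ ∙ A) → 𝒟 (s₁ ∙ s₃ ∙ A) → 𝒟 (s₂ ∙ s₃ ∙ A) →
                    𝒟 (s₁ ∙ s₂ ∙ s₃ ∙ A)

{-# OPTIONS --safe #-}

-- A simplex of the link of A with ordered vertices is the same as a cubic
-- sequence s of glides whose cube based at A lies in 𝒟, and its vertices are
-- the entries of s.  Independent glides are distinct, so links are always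
-- simplicial complexes.  Pre-cubic pairs are cubic, so a family of pairwise
-- adjacent vertices is a pre-cubic s with A, all sᵢA and all sᵢsⱼA in 𝒟;
-- flagness thus says that every such s is cubic and spans a cube in 𝒟.  The
-- cube in 𝒟 comes from the cube condition by induction on the length of s.

module Submission where

open import Defs
open import Algebra.Bundles using (Group)
import Algebra.Properties.Group as GroupProperties
open import Data.Bool.Base using (true; false; _xor_; if_then_else_)
open import Data.Bool.Properties using (xor-assoc; xor-same)
open import Data.Empty using (⊥-elim)
open import Data.Fin.Base using (Fin; zero; suc)
open import Data.Fin.Properties using (_≟_; suc-injective)
open import Data.Nat.Base using (zero; suc)
open import Data.Product.Base using (_×_; _,_; proj₁; proj₂)
open import Data.Vec.Functional using (Vector; []; _∷_; tail)
open import Function.Base using (_∘_)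
open import Function.Bundles using (_⇔_; _↣_; mk⇔; mk↣)
open import Function.Construct.Identity using (↣-id)
open import Level using (_⊔_)
open import Relation.Binary.Core using (Rel)
open import Relation.Binary.Definitions using (_Respects_; Symmetric)
open import Relation.Binary.PropositionalEquality
  using (_≡_; _≢_; _≗_; refl; sym; trans; cong)
import Relation.Binary.Reasoning.Setoid as ≈-Reasoning
open import Relation.Nullary using (yes; no; contradiction)
open import Relation.Unary using (Pred)

-- Families of related elements and reflections of cubes

pairwise-∷ : ∀ {a r} {A : Set a} {R : Rel A r} {k} {x : A} {xs : Vector A k} →
             Symmetric R → (∀ i → R x (xs i)) →
             (∀ {i j} → i ≢ j → R (xs i) (xs j)) →
             ∀ {i j} → i ≢ j → R ((x ∷ xs) i) ((x ∷ xs) j)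
pairwise-∷ symR Rx Rxs {zero}  {zero}  i≢j = contradiction refl i≢j
pairwise-∷ symR Rx Rxs {zero}  {suc j} i≢j = Rx j
pairwise-∷ symR Rx Rxs {suc i} {zero}  i≢j = symR (Rx i)
pairwise-∷ symR Rx Rxs {suc i} {suc j} i≢j = Rxs (i≢j ∘ cong suc)

reflection : ∀ {k} → Vertex k → FaceMap k k
reflection T = faceMap T (↣-id _)

apply-reflection : ∀ {k} (T U : Vertex k) → apply (reflection T) U ≗ λ m → T m xor U m
apply-reflection T U m = cong (T m xor_) (spread-hit (↣-id _) U m)

-- Pre-cubic and cubic sequences

module _ {c ℓ g h} {G : Group c ℓ} (𝒮 : GlidingSystem G g h) where
  open Group G renaming (refl to ≈-refl; sym to ≈-sym; trans to ≈-trans)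
  open GlidingSystem 𝒮
  open GroupProperties G using (identityˡ-unique)

  prod-comm : ∀ {k} {s : Vector Carrier k} {t} → (∀ i → s i ∙ t ≈ t ∙ s i) →
              ∀ T → prod 𝒮 s T ∙ t ≈ t ∙ prod 𝒮 s T
  prod-comm {zero}  comm T = ≈-trans (identityˡ _) (≈-sym (identityʳ _))
  prod-comm {suc k} {s} {t} comm T = begin
    sT ∙ prod 𝒮 (tail s) (tail T) ∙ t    ≈⟨ assoc _ _ _ ⟩
    sT ∙ (prod 𝒮 (tail s) (tail T) ∙ t)  ≈⟨ ∙-congˡ (prod-comm (comm ∘ suc) (tail T)) ⟩
    sT ∙ (t ∙ prod 𝒮 (tail s) (tail T))  ≈⟨ assoc _ _ _ ⟨
    sT ∙ t ∙ prod 𝒮 (tail s) (tail T)    ≈⟨ ∙-congʳ (if-comm 𝒮 (T zero) (comm zero)) ⟩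
    t ∙ sT ∙ prod 𝒮 (tail s) (tail T)    ≈⟨ assoc _ _ _ ⟩
    t ∙ (sT ∙ prod 𝒮 (tail s) (tail T))  ∎
    where
    open ≈-Reasoning setoid
    sT = if T zero then s zero else ε

  PreCubic⇒injective : ∀ {k} {s : Vector Carrier k} → PreCubic 𝒮 s →
                       ∀ {i j} → s i ≈ s j → i ≡ j
  PreCubic⇒injective pc {i} {j} eq with i ≟ j
  ... | yes i≡j = i≡j
  ... | no  i≢j = ⊥-elim (Indep⇒≉ 𝒮 (proj₂ pc i≢j) eq)

  PreCubic-[] : PreCubic 𝒮 []
  PreCubic-[] = (λ ()) , λ { {()} }

  PreCubic-∷ : ∀ {k} {s} {t : Vector Carrier k} → Glide s → (∀ i → Indep s (t i)) →
               PreCubic 𝒮 t → PreCubic 𝒮 (s ∷ t)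
  PreCubic-∷ gl ind (gls , inds) =
    (λ { zero → gl ; (suc i) → gls i }) , pairwise-∷ {R = Indep} Indep-sym ind inds

  Cubic-resp : ∀ {k} {s t : Vector Carrier k} → (∀ i → s i ≈ t i) →
               PreCubic 𝒮 t → Cubic 𝒮 s → Cubic 𝒮 t
  Cubic-resp s≈t pc (_ , distinct) = pc , λ T₁ T₂ T₁≢T₂ eq → distinct T₁ T₂ T₁≢T₂
    (≈-trans (prod-cong 𝒮 {T = T₁} s≈t (λ _ → refl))
      (≈-trans eq (≈-sym (prod-cong 𝒮 {T = T₂} s≈t (λ _ → refl)))))

  -- Viewed from the vertex T₂, distinctness of the vertices of a cube says
  -- that the other vertices differ from the origin.
  cubic-if-≉ε : ∀ {k} → (∀ {s : Vector Carrier k} → PreCubic 𝒮 s →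
                         ∀ T → prod 𝒮 s T ≈ ε → T ≗ 𝟎) →
                ∀ {s : Vector Carrier k} → PreCubic 𝒮 s → Cubic 𝒮 s
  cubic-if-≉ε prod≈ε⇒𝟎 {s} pc = pc , λ T₁ T₂ T₁≢T₂ eq →
    let e = reflection T₂
        U = λ m → T₂ m xor T₁ m
        U-moves : apply e U ≗ T₁
        U-moves m = trans (apply-reflection T₂ U m)
                      (trans (sym (xor-assoc (T₂ m) (T₂ m) (T₁ m)))
                        (cong (_xor T₁ m) (xor-same (T₂ m))))
        -- By `prod-apply`, [T₁] is the product of `moved s e` over `U` times [T₂], so [T₁] ≈ [T₂]
        -- cancels to a product equal to `ε`.
        U≗𝟎 = prod≈ε⇒𝟎 (moved-PreCubic 𝒮 pc e) U (identityˡ-unique _ _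
                (≈-trans (≈-sym (prod-apply 𝒮 pc e U))
                  (≈-trans (prod-cong 𝒮 {s = s} (λ _ → ≈-refl) U-moves) eq)))
    in T₁≢T₂ λ m → xor≡false (T₂ m) (T₁ m) (U≗𝟎 m)
    where
    xor≡false : ∀ x y → x xor y ≡ false → y ≡ x
    xor≡false true  true  _ = refl
    xor≡false false y     eq = eq

  PreCubic⇒Cubic₀ : {s : Vector Carrier 0} → PreCubic 𝒮 s → Cubic 𝒮 s
  PreCubic⇒Cubic₀ = cubic-if-≉ε λ _ _ _ ()

  PreCubic⇒Cubic₁ : {s : Vector Carrier 1} → PreCubic 𝒮 s → Cubic 𝒮 s
  PreCubic⇒Cubic₁ = cubic-if-≉ε prod≈ε⇒𝟎
    where
    prod≈ε⇒𝟎 : ∀ {s : Vector Carrier 1} → PreCubic 𝒮 s → ∀ T → prod 𝒮 s T ≈ ε → T ≗ 𝟎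
    prod≈ε⇒𝟎 (gl , _) T eq zero with T zero
    ... | false = refl
    ... | true  = ⊥-elim (Glide⇒≉ε (gl zero) (≈-trans (≈-sym (identityʳ _)) eq))

  -- The nonempty subsets have products s, t and st, and the axioms of a gliding system exclude `ε`
  -- for each. Triples can fail: in (Z/2)², with distinct nontrivial elements independent, the three
  -- glides have product 1.
  PreCubic⇒Cubic₂ : {s : Vector Carrier 2} → PreCubic 𝒮 s → Cubic 𝒮 s
  PreCubic⇒Cubic₂ = cubic-if-≉ε prod≈ε⇒𝟎
    where
    prod≈ε⇒𝟎 : ∀ {s : Vector Carrier 2} → PreCubic 𝒮 s → ∀ T → prod 𝒮 s T ≈ ε → T ≗ 𝟎
    prod≈ε⇒𝟎 (gl , ind) T eq m with T zero in T₀ | T (suc zero) in T₁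
    prod≈ε⇒𝟎 (gl , ind) T eq zero       | false | false = T₀
    prod≈ε⇒𝟎 (gl , ind) T eq (suc zero) | false | false = T₁
    ... | true  | false = ⊥-elim (Glide⇒≉ε (gl zero)
          (≈-trans (≈-sym (≈-trans (∙-congˡ (identityˡ _)) (identityʳ _))) eq))
    ... | false | true  = ⊥-elim (Glide⇒≉ε (gl (suc zero))
          (≈-trans (≈-sym (≈-trans (identityˡ _) (identityʳ _))) eq))
    ... | true  | true  = ⊥-elim (Indep-≉ε (ind {zero} {suc zero} λ ())
          (≈-trans (≈-sym (∙-congˡ (identityʳ _))) eq))

  -- Squares and cubes at a vertex of the glide complex

  module _ {d} (𝒟 : Pred Carrier d) (𝒟-resp : 𝒟 Respects _≈_) where

    private
      X = glideComplex 𝒮 𝒟 𝒟-resp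

    open CubedComplex X using (Cell)

    -- For edges at `A` that lie in `𝒟`, this is adjacency of the corresponding vertices of the
    -- link.
    CompatibleAt : Carrier → Rel Carrier (h ⊔ d)
    CompatibleAt A s t = Indep s t × 𝒟 (s ∙ t ∙ A)

    CompatibleAt-sym : ∀ {A} → Symmetric (CompatibleAt A)
    CompatibleAt-sym (ind , D) = Indep-sym ind , 𝒟-resp (∙-congʳ (Indep-comm ind)) D

    -- The common input of regularity and flagness. It concerns only the edges and squares that
    -- contain `A`, not those elsewhere in the prospective cube.
    record Spans2Skeleton (A : Carrier) {k} (s : Vector Carrier k) : Set (g ⊔ h ⊔ d) where
      field
        base∈𝒟     : 𝒟 A
        glide      : ∀ i → Glide (s i)
        edge∈𝒟     : ∀ i → 𝒟 (s i ∙ A)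
        compatible : ∀ {i j} → i ≢ j → CompatibleAt A (s i) (s j)

      preCubic : PreCubic 𝒮 s
      preCubic = glide , λ i≢j → proj₁ (compatible i≢j)

    open Spans2Skeleton

    SpansCube : Carrier → ∀ {k} → Vector Carrier k → Set (ℓ ⊔ g ⊔ h ⊔ d)
    SpansCube A s = Cubic 𝒮 s × (∀ T → 𝒟 (prod 𝒮 s T ∙ A))

    SpansCube-resp : ∀ {A k} {s t : Vector Carrier k} → (∀ i → s i ≈ t i) →
                     PreCubic 𝒮 t → SpansCube A s → SpansCube A t
    SpansCube-resp s≈t pc (cub , D) =
      Cubic-resp s≈t pc cub , λ T → 𝒟-resp (∙-congʳ (prod-cong 𝒮 {T = T} s≈t (λ _ → refl))) (D T)

    spansCube₁ : ∀ {A s} → 𝒟 A → Glide s → 𝒟 (s ∙ A) → SpansCube A (s ∷ [])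
    spansCube₁ {A} {s} D gl Ds =
      PreCubic⇒Cubic₁ (PreCubic-∷ gl (λ ()) PreCubic-[]) , vertex∈𝒟
      where
      vertex∈𝒟 : ∀ T → 𝒟 (prod 𝒮 (s ∷ []) T ∙ A)
      vertex∈𝒟 T with T zero
      ... | false = 𝒟-resp (≈-sym (≈-trans (∙-congʳ (identityˡ _)) (identityˡ _))) D
      ... | true  = 𝒟-resp (∙-congʳ (≈-sym (identityʳ _))) Ds

    spansCube₂ : ∀ {A s t} → 𝒟 A → 𝒟 (s ∙ A) → 𝒟 (t ∙ A) → CompatibleAt A s t →
                 SpansCube A (s ∷ t ∷ [])
    spansCube₂ {A} {s} {t} D Ds Dt (ind , Dst) =
      PreCubic⇒Cubic₂ (PreCubic-∷ gs (λ { zero → ind }) (PreCubic-∷ gt (λ ()) PreCubic-[])) ,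
      vertex∈𝒟
      where
      gs = proj₁ (Indep⇒Glide ind)
      gt = proj₂ (Indep⇒Glide ind)
      vertex∈𝒟 : ∀ T → 𝒟 (prod 𝒮 (s ∷ t ∷ []) T ∙ A)
      vertex∈𝒟 T with T zero
      ... | false = 𝒟-resp (∙-congʳ (≈-sym (identityˡ _)))
                           (proj₂ (spansCube₁ D gt Dt) (tail T))
      ... | true with T (suc zero)
      ...   | false = 𝒟-resp (∙-congʳ (≈-sym (≈-trans (∙-congˡ (identityˡ _)) (identityʳ _)))) Ds
      ...   | true  = 𝒟-resp (∙-congʳ (∙-congˡ (≈-sym (identityʳ _)))) Dst

    -- Passing to the facet at s₀A, the cube condition provides its 2-skeleton.
    vertices∈𝒟 : CubeCondition 𝒮 𝒟 → ∀ {k A} {s : Vector Carrier k} →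
                 Spans2Skeleton A s → ∀ T → 𝒟 (prod 𝒮 s T ∙ A)
    vertices∈𝒟 cube {zero}          sk T = 𝒟-resp (≈-sym (identityˡ _)) (base∈𝒟 sk)
    vertices∈𝒟 cube {suc k} {A} {s} sk T with T zero
    ... | false = 𝒟-resp (∙-congʳ (≈-sym (identityˡ _))) (vertices∈𝒟 cube facet (tail T))
      where
      facet : Spans2Skeleton A (tail s)
      facet = record
        { base∈𝒟     = base∈𝒟 sk
        ; glide      = λ i → glide sk (suc i)
        ; edge∈𝒟     = λ i → edge∈𝒟 sk (suc i)
        ; compatible = λ i≢j → compatible sk (i≢j ∘ suc-injective)
        }
    ... | true = 𝒟-resp
      -- Moving s₀ to the right end of the product turns [T]A into a vertex of the facet based at
      -- s₀A.
      (≈-trans (≈-sym (assoc _ _ _))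
        (∙-congʳ (prod-comm (λ i → Indep-comm (proj₁ (compatible sk {suc i} {zero} λ ()))) (tail T))))
      (vertices∈𝒟 cube facet (tail T))
      where
      facet : Spans2Skeleton (s zero ∙ A) (tail s)
      facet = record
        { base∈𝒟     = edge∈𝒟 sk zero
        ; glide      = λ i → glide sk (suc i)
        ; edge∈𝒟     = λ i → 𝒟-resp (assoc _ _ _) (proj₂ (compatible sk {suc i} {zero} λ ()))
        ; compatible = λ {i} {j} i≢j →
            let ij = compatible sk (i≢j ∘ suc-injective)
                i0 = compatible sk {suc i} {zero} λ ()
                j0 = compatible sk {suc j} {zero} λ ()
            in proj₁ ij , 𝒟-resp (assoc _ _ _)
                 -- With s₀ as the third glide, the resulting vertex sᵢsⱼs₀A regroups as sᵢsⱼ(s₀A),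
                 -- the far corner of a square at s₀A.
                 (cube (base∈𝒟 sk) (proj₁ ij) (proj₁ i0) (proj₁ j0)
                       (edge∈𝒟 sk (suc i)) (edge∈𝒟 sk (suc j)) (edge∈𝒟 sk zero)
                       (proj₂ ij) (proj₂ i0) (proj₂ j0))
        }

    vertexAt : ∀ {A} → 𝒟 A → Cell 0
    vertexAt {A} D = basedCube A [] (PreCubic⇒Cubic₀ PreCubic-[]) ,
                     λ _ → 𝒟-resp (≈-sym (identityˡ A)) D

    -- Simplices of the link as sequences of glides

    module _ (A₀ : Cell 0) where

      private
        A = BasedCube.base (proj₁ A₀)

      open SimplexComplex (link X A₀)
        using (Simplex; face; corner; _⊆ᵛ_; Adjacent) renaming (_≈_ to _≈ₗ_)

      dirs : ∀ {n} → Simplex n → Vector Carrier (suc n)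
      dirs σ = BasedCube.dirs (proj₁ (proj₁ σ))

      base≈A : ∀ {n} (σ : Simplex n) → BasedCube.base (proj₁ (proj₁ σ)) ≈ A
      base≈A ((basedCube B s _ , _) , B≈A , _) =
        ≈-trans (≈-sym (≈-trans (∙-congʳ (prod-𝟎 𝒮 s)) (identityˡ B))) B≈A

      -- The base of the cube is forced to be `A`, so only the directions can tell simplices apart.
      simplex-≈ : ∀ {n} {σ τ : Simplex n} → (∀ i → dirs σ i ≈ dirs τ i) → σ ≈ₗ τ
      simplex-≈ {σ = σ} {τ} eq = ≈-trans (base≈A σ) (≈-sym (base≈A τ)) , eq

      simplex⇒spansCube : ∀ {n} (σ : Simplex n) → SpansCube A (dirs σ)
      simplex⇒spansCube σ@((basedCube B s cub , D) , _) =
        cub , λ T → 𝒟-resp (∙-congˡ (base≈A σ)) (D T)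

      spansCube⇒simplex : ∀ {n} {s : Vector Carrier (suc n)} → SpansCube A s → Simplex n
      spansCube⇒simplex {s = s} (cub , D) =
        (basedCube A s cub , D) , ≈-trans (∙-congʳ (prod-𝟎 𝒮 s)) (identityˡ A) , λ ()

      link-isSimplicial : IsSimplicialComplex (link X A₀)
      link-isSimplicial = record
        { embedded   = λ σ eq → PreCubic⇒injective (preCubicOf σ) (proj₂ eq zero)
        ; determined = λ σ τ σ⊆τ _ →
            let p = matching σ τ σ⊆τ
            in p , simplex-≈ {σ = σ} {face τ p} (λ i → proj₂ (proj₂ (σ⊆τ i)) zero)
        }
        where
        preCubicOf : ∀ {n} (σ : Simplex n) → PreCubic 𝒮 (dirs σ)
        preCubicOf σ = proj₁ (proj₁ (simplex⇒spansCube σ))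
        -- A corner of `σ` goes to a corner of `τ` carrying the same glide; a repeated value would
        -- force a repetition among the entries of `dirs σ`, which are pairwise independent.
        matching : ∀ {n} (σ τ : Simplex n) → σ ⊆ᵛ τ → Fin (suc n) ↣ Fin (suc n)
        matching σ τ σ⊆τ = mk↣ {to = λ i → proj₁ (σ⊆τ i)} λ {i} {j} eq →
          PreCubic⇒injective (preCubicOf σ)
            (≈-trans (proj₂ (proj₂ (σ⊆τ i)) zero)
              (≈-trans (reflexive (cong (dirs τ) eq))
                (≈-sym (proj₂ (proj₂ (σ⊆τ j)) zero))))

      -- Flagness of the link

      adjacent⇒compatible : ∀ u v → Adjacent u v → CompatibleAt A (dirs u zero) (dirs v zero)
      adjacent⇒compatible u v (e , (_ , e₀≈u) , (_ , e₁≈v)) =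
        let ((_ , ind) , _) , D = simplex⇒spansCube e
        in proj₁ Indep-resp (e₁≈v zero)
             (proj₂ Indep-resp (e₀≈u zero) (ind {zero} {suc zero} λ ())) ,
           𝒟-resp (∙-congʳ (∙-cong (e₀≈u zero) (≈-trans (identityʳ _) (e₁≈v zero))))
                  -- The full subset selects the vertex of the square opposite to `A`.
                  (D λ _ → true)

      -- The glides of the given vertices form a sequence whose edges and squares at `A` lie in `𝒟`.
      -- Regularity makes it cubic, and the cube condition supplies the remaining vertices of its
      -- cube.
      link-isFlag : Regular 𝒮 𝒟 → CubeCondition 𝒮 𝒟 → IsFlag (link X A₀)
      link-isFlag regular cube {n} v adj =
        spansCube⇒simplex (cub , vertices∈𝒟 cube sk) ,
        -- Faces through the origin invert no glide, so the direction of the i-th corner is `s i` by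
        -- computation.
        λ i → simplex-≈ {σ = corner (spansCube⇒simplex (cub , vertices∈𝒟 cube sk)) i} {v i}
                        λ { zero → ≈-refl }
        where
        s : Vector Carrier (suc n)
        s i = dirs (v i) zero
        sk : Spans2Skeleton A s
        sk = record
          { base∈𝒟     = 𝒟-resp (identityˡ A) (proj₂ A₀ 𝟎)
          ; glide      = λ i → proj₁ (proj₁ (proj₁ (simplex⇒spansCube (v i)))) zero
          ; edge∈𝒟     = λ i → 𝒟-resp (∙-congʳ (identityʳ _))
                                 (proj₂ (simplex⇒spansCube (v i)) λ _ → true)
          ; compatible = λ i≢j → adjacent⇒compatible (v _) (v _) (adj i≢j)
          }
        cub : Cubic 𝒮 s
        cub = regular (base∈𝒟 sk) s (preCubic sk) (edge∈𝒟 sk) (λ i≢j → proj₂ (compatible sk i≢j))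

      -- Each glide gives an edge at `A`, hence a vertex of the link, and each compatible pair gives
      -- a square joining two of them. The simplex filling these vertices has directions equal to
      -- `s` only up to `≈`, whence the transport by `SpansCube-resp`.
      flag⇒spansCube : IsFlag (link X A₀) → ∀ {n} {s : Vector Carrier (suc n)} →
                       Spans2Skeleton A s → SpansCube A s
      flag⇒spansCube flag {n} {s} sk =
        let σ , σ≈v = flag v adj
        in SpansCube-resp (λ i → proj₂ (σ≈v i) zero) (preCubic sk) (simplex⇒spansCube σ)
        where
        v : Fin (suc n) → Simplex 0
        v i = spansCube⇒simplex (spansCube₁ (base∈𝒟 sk) (glide sk i) (edge∈𝒟 sk i))
        adj : ∀ {i j} → i ≢ j → Adjacent (v i) (v j)
        adj {i} {j} i≢j =
          let e = spansCube⇒simplex (spansCube₂ (base∈𝒟 sk) (edge∈𝒟 sk i) (edge∈𝒟 sk j)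
                                                (compatible sk i≢j))
          in e , simplex-≈ {σ = corner e zero} {v i} (λ { zero → ≈-refl })
               , simplex-≈ {σ = corner e (suc zero)} {v j} (λ { zero → ≈-refl })

    -- The two implications of the equivalence

    nonpositivelyCurved⇒regular : NonpositivelyCurved X → Regular 𝒮 𝒟
    -- Simplices of the link have at least one vertex, so the empty sequence is treated apart.
    nonpositivelyCurved⇒regular npc D {zero}  s pc _ _ = PreCubic⇒Cubic₀ pc
    nonpositivelyCurved⇒regular npc D {suc k} s pc Ds Dss =
      proj₁ (flag⇒spansCube (vertexAt D) (proj₂ (npc (vertexAt D))) record
        { base∈𝒟     = D
        ; glide      = proj₁ pc
        ; edge∈𝒟     = Ds
        ; compatible = λ i≢j → proj₂ pc i≢j , Dss i≢j
        })

    -- Flagness fills the three edges at `A` with a 3-cube in `𝒟`, and s₁s₂s₃A is its vertex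
    -- opposite to `A`.
    nonpositivelyCurved⇒cubeCondition : NonpositivelyCurved X → CubeCondition 𝒮 𝒟
    nonpositivelyCurved⇒cubeCondition npc {A} {s₁} {s₂} {s₃} D i₁₂ i₁₃ i₂₃ D₁ D₂ D₃ D₁₂ D₁₃ D₂₃ =
      𝒟-resp (∙-congʳ (≈-trans (∙-congˡ (∙-congˡ (identityʳ s₃))) (≈-sym (assoc s₁ s₂ s₃))))
        (proj₂ (flag⇒spansCube (vertexAt D) (proj₂ (npc (vertexAt D))) sk) λ _ → true)
      where
      sk : Spans2Skeleton A (s₁ ∷ s₂ ∷ s₃ ∷ [])
      sk = record
        { base∈𝒟     = D
        ; glide      = λ { zero → proj₁ (Indep⇒Glide i₁₂)
                         ; (suc zero) → proj₂ (Indep⇒Glide i₁₂)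
                         ; (suc (suc zero)) → proj₂ (Indep⇒Glide i₁₃) }
        ; edge∈𝒟     = λ { zero → D₁ ; (suc zero) → D₂ ; (suc (suc zero)) → D₃ }
        ; compatible =
            pairwise-∷ {R = CompatibleAt A} {xs = s₂ ∷ s₃ ∷ []} CompatibleAt-sym
              (λ { zero → i₁₂ , D₁₂ ; (suc zero) → i₁₃ , D₁₃ })
              (pairwise-∷ {R = CompatibleAt A} {xs = s₃ ∷ []} CompatibleAt-sym (λ { zero → i₂₃ , D₂₃ })
                (pairwise-∷ {R = CompatibleAt A} {xs = []} CompatibleAt-sym (λ ()) λ { {()} }))
        }

    nonpositivelyCurved⇒regular∧cubeCondition :
      NonpositivelyCurved X → Regular 𝒮 𝒟 × CubeCondition 𝒮 𝒟
    nonpositivelyCurved⇒regular∧cubeCondition npc =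
      nonpositivelyCurved⇒regular npc , nonpositivelyCurved⇒cubeCondition npc

    regular∧cubeCondition⇒nonpositivelyCurved :
      Regular 𝒮 𝒟 × CubeCondition 𝒮 𝒟 → NonpositivelyCurved X
    regular∧cubeCondition⇒nonpositivelyCurved (regular , cube) A₀ =
      link-isSimplicial A₀ , link-isFlag A₀ regular cube

theorem4p4 : ∀ {c ℓ g h d} (G : Group c ℓ) (𝒮 : GlidingSystem G g h)
    (𝒟 : Pred (Group.Carrier G) d) (𝒟-resp : 𝒟 Respects Group._≈_ G) →
    NonpositivelyCurved (glideComplex 𝒮 𝒟 𝒟-resp) ⇔ (Regular 𝒮 𝒟 × CubeCondition 𝒮 𝒟)
theorem4p4 G 𝒮 𝒟 𝒟-resp = mk⇔
  (nonpositivelyCurved⇒regular∧cubeCondition 𝒮 𝒟 𝒟-resp)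
  (regular∧cubeCondition⇒nonpositivelyCurved 𝒮 𝒟 𝒟-resp)
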